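{- For all integers $b \geq 2$ and $2 \leq k \leq b$, there exists a connected graph $G$ on $b$ vertices such that $f_d(G,v)=k$ for every starting vertex $v \in V(G)$.
   Context: All graphs are finite and simple; $\mathrm{dist}(u,v)$ denotes the length of a shortest path between $u$ and $v$ in $G$. Explorer-Director game on a connected graph $G$ with starting vertex $v$: a token is initially at $v$ (so $v$ counts as visited). On each turn the Explorer names a distance $d$ such that at least one vertex of $G$ is at distance exactly $d$ from the token's current position, and then the Director moves the token to a vertex of their choice at distance exactly $d$ from the current position. The Explorer wants to maximize, and the Director to minimize, the number of distinct vertices visited by the token; play continues until the Explorer can no longer force the token onto an unvisited vertex. $f_d(G,v)$ is the number of visited vertices at the end of the game under optimal play by both players; equivalently, it is the largest $k$ such that the Explorer has a (possibly adaptive) strategy guaranteeing, against every play of the Director, that at least $k$ distinct vertices (including $v$) are visited after finitely many turns. -}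

module Defs where

open import Level using (0ℓ)
open import Data.Nat using (ℕ; zero; suc; _≤_)
open import Data.Fin using (Fin)
open import Data.Fin.Subset using (Subset; ⁅_⁆; _∪_; ∣_∣)
open import Data.Product using (Σ-syntax; ∃-syntax; _×_)
open import Relation.Binary.Core using (Rel)
open import Relation.Binary.Definitions using (Decidable; Irreflexive; Symmetric)
open import Relation.Binary.Construct.Closure.ReflexiveTransitive using (Star; fold)
open import Relation.Binary.PropositionalEquality using (_≡_)

record SimpleGraph (n : ℕ) : Set₁ where
  field
    Adj    : Rel (Fin n) 0ℓ
    adj?   : Decidable Adj
    sym    : Symmetric Adj
    irrefl : Irreflexive _≡_ Adj

module _ {n : ℕ} (G : SimpleGraph n) where
  open SimpleGraph G

  Walk : Rel (Fin n) 0ℓ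
  Walk = Star Adj

  length : ∀ {u v} → Walk u v → ℕ
  length = fold (λ _ _ → ℕ) (λ _ ℓ → suc ℓ) zero

  Connected : Set
  Connected = ∀ u v → Walk u v

  -- dist(u,v) = d.  Minimising over walks rather than paths gives the same
  -- number, since a shortest walk repeats no vertex.
  IsDist : Fin n → Fin n → ℕ → Set
  IsDist u v d = (Σ[ p ∈ Walk u v ] length p ≡ d) × (∀ (q : Walk u v) → d ≤ length q)

  -- CanForce k S u: with the token at u and S the set of vertices visited so
  -- far, the Explorer has an adaptive strategy after which at least k distinct
  -- vertices have been visited.  An element is such a strategy, as a tree
  -- branching over the Director's replies; being inductive, it reaches `done`
  -- after finitely many turns in every play.
  data CanForce (k : ℕ) (S : Subset n) (u : Fin n) : Set where
    done : k ≤ ∣ S ∣ → CanForce k S u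
    move : (d : ℕ) →
           ∃[ w ] IsDist u w d →
           (∀ w → IsDist u w d → CanForce k (S ∪ ⁅ w ⁆) w) →
           CanForce k S u

  -- f_d(G,v) = k, given as a relation: k is the largest number of visited
  -- vertices that the Explorer can guarantee from the start vertex v.
  IsFd : Fin n → ℕ → Set
  IsFd v k = CanForce k ⁅ v ⁆ v × (∀ m → CanForce m ⁅ v ⁆ v → m ≤ k)

{-# OPTIONS --safe #-}
-- Take a path on the classes 0, …, k-1 and replace its last vertex by a clique
-- of b-k+1 twins.  The Director never uses more than one vertex of each class:
-- a call answered by another vertex of a class can be answered by the chosen
-- one, and a call of distance 1 between twins can be answered by class k-2.
-- The Explorer can always bring the token to the leaf, class 0: from the far
-- half of the path directly, from the near half via the clique, and from the
-- centre after one step.  From the leaf every class can be named exactly, so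
-- all k classes get visited.  For k = 2 the graph is complete, the Explorer
-- cannot leave the clique at will, but a single call of distance 1 is enough.
module Submission where

open import Defs
open import Data.Empty using (⊥-elim)
import Data.Fin as Fin
open import Data.Fin using (Fin; toℕ; fromℕ<; _≟_)
open import Data.Fin.Properties using (toℕ-injective; toℕ-fromℕ<)
open import Data.Fin.Subset using (Subset; inside; outside; ⊥; ⁅_⁆; _∪_; _∈_; _∉_; _⊆_; ∣_∣) renaming (_-_ to _∖_)
open import Data.Fin.Subset.Properties using
  ( ∣⊥∣≡0; ∣⁅x⁆∣≡1; ∪-identityʳ; x∈⁅x⁆; x∈⁅y⁆⇒x≡y; p⊆p∪q; q⊆p∪q; x∈p∪q⁻
  ; p⊆q⇒∣p∣≤∣q∣; p⊂q⇒∣p∣<∣q∣; x∈p⇒∣p-x∣<∣p∣; x∈p∧x≢y⇒x∈p-y)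
open import Data.Nat using (ℕ; zero; suc; _+_; _∸_; _⊓_; ∣_-_∣; _≤_; _<_; z≤n; s≤s; _≤?_)
import Data.Nat as ℕ
open import Data.Nat.Properties hiding (_≟_; _≤?_)
open import Data.Product using (Σ-syntax; ∃-syntax; _×_; _,_; proj₁; proj₂)
open import Data.Sum using (_⊎_; inj₁; inj₂)
open import Data.Vec using (_∷_)
open import Function using (_∘_)
open import Relation.Binary.Construct.Closure.ReflexiveTransitive using (ε; _◅_)
open import Relation.Binary.Definitions using (tri<; tri≈; tri>)
open import Relation.Binary.PropositionalEquality
open import Relation.Nullary using (yes; no; ¬?; _×-dec_)

private
  variable
    n : ℕ

-- Sizes of subsets, bounded from above by images and from below by classes met.

∣p∪⁅x⁆∣≤1+∣p∣ : ∀ (p : Subset n) x → ∣ p ∪ ⁅ x ⁆ ∣ ≤ suc ∣ p ∣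
∣p∪⁅x⁆∣≤1+∣p∣ (inside  ∷ p) Fin.zero    rewrite ∪-identityʳ p = n≤1+n _
∣p∪⁅x⁆∣≤1+∣p∣ (outside ∷ p) Fin.zero    rewrite ∪-identityʳ p = ≤-refl
∣p∪⁅x⁆∣≤1+∣p∣ (inside  ∷ p) (Fin.suc x) = s≤s (∣p∪⁅x⁆∣≤1+∣p∣ p x)
∣p∪⁅x⁆∣≤1+∣p∣ (outside ∷ p) (Fin.suc x) = ∣p∪⁅x⁆∣≤1+∣p∣ p x

∪-lub : ∀ {p q r : Subset n} → p ⊆ r → q ⊆ r → p ∪ q ⊆ r
∪-lub {p = p} {q} p⊆r q⊆r x∈ with x∈p∪q⁻ p q x∈
... | inj₁ x∈p = p⊆r x∈p
... | inj₂ x∈q = q⊆r x∈q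

⁅x⁆⊆p : ∀ {p : Subset n} {x} → x ∈ p → ⁅ x ⁆ ⊆ p
⁅x⁆⊆p {p = p} x∈p y∈ = subst (_∈ p) (sym (x∈⁅y⁆⇒x≡y _ y∈)) x∈p

x∈p∪⁅x⁆ : ∀ (p : Subset n) x → x ∈ p ∪ ⁅ x ⁆
x∈p∪⁅x⁆ p x = q⊆p∪q p ⁅ x ⁆ (x∈⁅x⁆ x)

image : (ℕ → Fin n) → ℕ → Subset n
image f zero    = ⊥
image f (suc m) = image f m ∪ ⁅ f m ⁆

∣image∣≤ : ∀ (f : ℕ → Fin n) m → ∣ image f m ∣ ≤ m
∣image∣≤ {n} f zero = ≤-reflexive (∣⊥∣≡0 n)
∣image∣≤ f (suc m)  = ≤-trans (∣p∪⁅x⁆∣≤1+∣p∣ (image f m) (f m)) (s≤s (∣image∣≤ f m))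

∈-image : ∀ (f : ℕ → Fin n) {i m} → i < m → f i ∈ image f m
∈-image f {i} {suc m} i<1+m with m<1+n⇒m<n∨m≡n i<1+m
... | inj₁ i<m  = p⊆p∪q ⁅ f m ⁆ (∈-image f i<m)
... | inj₂ refl = x∈p∪⁅x⁆ (image f m) (f m)

Covers : (Fin n → ℕ) → ℕ → Subset n → Set
Covers c m p = ∀ {i} → i < m → ∃[ x ] (x ∈ p × c x ≡ i)

covers-mono : ∀ {c : Fin n → ℕ} {m p q} → p ⊆ q → Covers c m p → Covers c m q
covers-mono p⊆q cov i<m with cov i<m
... | x , x∈p , cx≡i = x , p⊆q x∈p , cx≡i

covers-suc : ∀ {c : Fin n → ℕ} {m p x} → x ∈ p → c x ≡ m → Covers c m p → Covers c (suc m) p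
covers-suc {x = x} x∈p cx≡m cov i<1+m with m<1+n⇒m<n∨m≡n i<1+m
... | inj₁ i<m  = cov i<m
... | inj₂ refl = x , x∈p , cx≡m

-- Removing the witness of the top class keeps the witnesses of all lower classes, since `c`
-- separates them from it; so each class accounts for an element of its own.
covers⇒≤∣p∣ : ∀ {c : Fin n → ℕ} m {p} → Covers c m p → m ≤ ∣ p ∣
covers⇒≤∣p∣         zero        cov = z≤n
covers⇒≤∣p∣ {c = c} (suc m) {p} cov with cov ≤-refl
... | x , x∈p , cx≡m = ≤-<-trans (covers⇒≤∣p∣ m rest) (x∈p⇒∣p-x∣<∣p∣ x∈p)
  where
  rest : Covers c m (p ∖ x)
  rest i<m with cov (m<n⇒m<1+n i<m)
  ... | y , y∈p , cy≡i = y , x∈p∧x≢y⇒x∈p-y y∈p y≢x , cy≡i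
    where
    y≢x : y ≢ x
    y≢x y≡x = <⇒≢ i<m (trans (sym cy≡i) (trans (cong c y≡x) cx≡m))

∣m-n∣≡d⇒ : ∀ m n {d} → ∣ m - n ∣ ≡ d → n ≡ m + d ⊎ n + d ≡ m
∣m-n∣≡d⇒ zero    n       eq = inj₁ eq
∣m-n∣≡d⇒ (suc m) zero    eq = inj₂ (sym eq)
∣m-n∣≡d⇒ (suc m) (suc n) eq with ∣m-n∣≡d⇒ m n eq
... | inj₁ n≡m+d = inj₁ (cong suc n≡m+d)
... | inj₂ n+d≡m = inj₂ (cong suc n+d≡m)

∣m-m+n∣′≡n : ∀ {l} m n → m + n ≡ l → ∣ m - l ∣ ≡ n
∣m-m+n∣′≡n m n refl = ∣m-m+n∣≡n m n

∣1+n-n∣≡1 : ∀ n → ∣ suc n - n ∣ ≡ 1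
∣1+n-n∣≡1 n = trans (∣-∣-comm (suc n) n) (∣m-m+n∣′≡n n 1 (+-comm n 1))

-- The graph, its classes and its distances.

module Lollipop (b K′ : ℕ) (K<b : suc K′ < b) where

  K : ℕ
  K = suc K′

  -- Truncation at `K` merges the vertices numbered `K` and above into the clique; each smaller
  -- class is a single vertex. With classes `0` to `K`, the value of the game is to be `suc K`.
  class : Fin b → ℕ
  class v = toℕ v ⊓ K

  class≤K : ∀ v → class v ≤ K
  class≤K v = m⊓n≤n (toℕ v) K

  -- For i > K this is the vertex K.
  at : ℕ → Fin b
  at i = fromℕ< (≤-<-trans (m⊓n≤n i K) K<b)

  class-at : ∀ {i} → i ≤ K → class (at i) ≡ i
  class-at {i} i≤K = begin
    toℕ (at i) ⊓ K ≡⟨ cong (_⊓ K) (toℕ-fromℕ< _) ⟩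
    (i ⊓ K) ⊓ K    ≡⟨ m≤n⇒m⊓n≡m (m⊓n≤n i K) ⟩
    i ⊓ K          ≡⟨ m≤n⇒m⊓n≡m i≤K ⟩
    i              ∎
    where open ≡-Reasoning

  class<K⇒class≡toℕ : ∀ v → class v < K → class v ≡ toℕ v
  class<K⇒class≡toℕ v v<K with ⊓-sel (toℕ v) K
  ... | inj₁ eq = eq
  ... | inj₂ eq = ⊥-elim (<⇒≢ v<K eq)

  class-injective : ∀ {u v} → class u ≡ class v → class u < K → u ≡ v
  class-injective {u} {v} eq u<K = toℕ-injective (begin
    toℕ u   ≡⟨ class<K⇒class≡toℕ u u<K ⟨
    class u ≡⟨ eq ⟩
    class v ≡⟨ class<K⇒class≡toℕ v (subst (_< K) eq u<K) ⟩
    toℕ v   ∎)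
    where open ≡-Reasoning

  G : SimpleGraph b
  G = record
    { Adj    = λ u v → u ≢ v × ∣ class u - class v ∣ ≤ 1
    ; adj?   = λ u v → ¬? (u ≟ v) ×-dec (∣ class u - class v ∣ ≤? 1)
    ; sym    = λ {u} {v} (u≢v , near) → ≢-sym u≢v , subst (_≤ 1) (∣-∣-comm (class u) (class v)) near
    ; irrefl = λ u≡v (u≢v , _) → u≢v u≡v
    }

  open SimpleGraph G using (Adj)

  adjacent : ∀ {u v} → ∣ class u - class v ∣ ≡ 1 → Adj u v
  adjacent {u} eq =
    (λ { refl → 1+n≢0 (trans (sym eq) (∣n-n∣≡0 (class u))) }) , ≤-reflexive eq

  -- An edge changes the class by at most one, and the triangle inequality adds this up along the
  -- walk.
  ∣class-class∣≤length : ∀ {u v} (p : Walk G u v) → ∣ class u - class v ∣ ≤ length G p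
  ∣class-class∣≤length {u} ε = ≤-reflexive (∣n-n∣≡0 (class u))
  ∣class-class∣≤length {u} {v} (_◅_ {j = w} (_ , near) p) =
    ≤-trans (∣-∣-triangle (class u) (class w) (class v)) (+-mono-≤ near (∣class-class∣≤length p))

  1≤length : ∀ {u v} → u ≢ v → (p : Walk G u v) → 1 ≤ length G p
  1≤length u≢v ε       = ⊥-elim (u≢v refl)
  1≤length u≢v (_ ◅ _) = s≤s z≤n

  -- The walk climbs through the vertices `at i`; only its last step goes to `v`, which may be any
  -- twin. The length is written `suc d` because equal classes do not make vertices equal.
  ascend : ∀ d {u v} → class v ≡ class u + suc d → Σ[ p ∈ Walk G u v ] length G p ≡ suc d
  ascend zero    {u}     eq = adjacent (∣m-m+n∣′≡n (class u) 1 (sym eq)) ◅ ε , refl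
  ascend (suc d) {u} {v} eq = step ◅ proj₁ rest , cong suc (proj₂ rest)
    where
    v≡ : class v ≡ suc (class u) + suc d
    v≡ = trans eq (+-suc (class u) (suc d))
    at-1+u : class (at (suc (class u))) ≡ suc (class u)
    at-1+u = class-at (≤-trans (m≤m+n _ (suc d)) (subst (_≤ K) v≡ (class≤K v)))
    step : Adj u (at (suc (class u)))
    step = adjacent (trans (cong ∣ class u -_∣ at-1+u) (∣m-m+n∣′≡n (class u) 1 (+-comm (class u) 1)))
    rest : Σ[ p ∈ Walk G (at (suc (class u))) v ] length G p ≡ suc d
    rest = ascend d (trans v≡ (cong (_+ suc d) (sym at-1+u)))

  descend : ∀ d {u v} → class v + suc d ≡ class u → Σ[ p ∈ Walk G u v ] length G p ≡ suc d
  descend zero    {u} {v} eq =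
    adjacent (trans (∣-∣-comm (class u) (class v)) (∣m-m+n∣′≡n (class v) 1 eq)) ◅ ε , refl
  descend (suc d) {u} {v} eq = step ◅ proj₁ rest , cong suc (proj₂ rest)
    where
    i : ℕ
    i = class v + suc d
    1+i≡u : suc i ≡ class u
    1+i≡u = trans (sym (+-suc (class v) (suc d))) eq
    at-i : class (at i) ≡ i
    at-i = class-at (<⇒≤ (subst (_≤ K) (sym 1+i≡u) (class≤K u)))
    step : Adj u (at i)
    step = adjacent (trans (cong₂ ∣_-_∣ (sym 1+i≡u) at-i) (∣1+n-n∣≡1 i))
    rest : Σ[ p ∈ Walk G (at i) v ] length G p ≡ suc d
    rest = descend d (sym at-i)

  isDist-between : ∀ {u v d} → ∣ class u - class v ∣ ≡ suc d → IsDist G u v (suc d)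
  isDist-between {u} {v} {d} eq = walk , λ p → subst (_≤ length G p) eq (∣class-class∣≤length p)
    where
    walk : Σ[ p ∈ Walk G u v ] length G p ≡ suc d
    walk with ∣m-n∣≡d⇒ (class u) (class v) eq
    ... | inj₁ v≡u+1+d = ascend d v≡u+1+d
    ... | inj₂ v+1+d≡u = descend d v+1+d≡u

  isDist-apart : ∀ {u v} d → class u ≢ class v → ∣ class u - class v ∣ ≡ d → IsDist G u v d
  isDist-apart zero    u≢v eq = ⊥-elim (u≢v (∣m-n∣≡0⇒m≡n eq))
  isDist-apart (suc _) _   eq = isDist-between eq

  isDist-twin : ∀ {u v} → class u ≡ class v → u ≢ v → IsDist G u v 1
  isDist-twin {u} {v} eq u≢v = ((u≢v , near) ◅ ε , refl) , 1≤length u≢v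
    where
    near : ∣ class u - class v ∣ ≤ 1
    near = subst (_≤ 1) (sym (m≡n⇒∣m-n∣≡0 eq)) z≤n

  isDist-refl : ∀ {u} → IsDist G u u 0
  isDist-refl = (ε , refl) , λ _ → z≤n

  isDist-unique : ∀ {u v d e} → IsDist G u v d → IsDist G u v e → d ≡ e
  isDist-unique ((p , refl) , p-min) ((q , refl) , q-min) = ≤-antisym (p-min q) (q-min p)

  isDist⇒∣class-class∣ : ∀ {u v d} → class u ≢ class v → IsDist G u v d → ∣ class u - class v ∣ ≡ d
  isDist⇒∣class-class∣ u≢v uv = isDist-unique (isDist-apart _ u≢v refl) uv

  connected : Connected G
  connected u v with ∣ class u - class v ∣ in eq
  ... | suc _ = proj₁ (proj₁ (isDist-between eq))
  ... | zero with u ≟ v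
  ...   | yes refl = ε
  ...   | no  u≢v  = proj₁ (proj₁ (isDist-twin (∣m-n∣≡0⇒m≡n eq) u≢v))

  -- The Director's strategy: the upper bound.

  module Director (v : Fin b) where

    -- The start vertex has to represent its own class, as it is visited from the outset.
    rep : ℕ → Fin b
    rep i with i ℕ.≟ class v
    ... | yes _ = v
    ... | no  _ = at i

    class-rep : ∀ {i} → i ≤ K → class (rep i) ≡ i
    class-rep {i} i≤K with i ℕ.≟ class v
    ... | yes i≡v = sym i≡v
    ... | no  _   = class-at i≤K

    rep-class : rep (class v) ≡ v
    rep-class with class v ℕ.≟ class v
    ... | yes _   = refl
    ... | no  v≢v = ⊥-elim (v≢v refl)

    reps : Subset b
    reps = image rep (suc K)

    -- Between different classes the distance depends on the classes alone, so `w` may be replaced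
    -- by its representative. Within one class the call is either 0, which leaves the token in
    -- place, or 1 between twins of the clique, and then class `K′` is also at distance 1.
    reply : ∀ {u w d} → IsDist G u w d → u ≡ w ⊎ (∃[ i ] (i ≤ K × IsDist G u (rep i) d))
    reply {u} {w} {d} uw with class u ℕ.≟ class w
    ... | no u≢w = inj₂ (class w , class≤K w , move-to-rep)
      where
      rep-w : class (rep (class w)) ≡ class w
      rep-w = class-rep (class≤K w)
      gap : ∣ class u - class (rep (class w)) ∣ ≡ d
      gap = trans (cong ∣ class u -_∣ rep-w) (isDist⇒∣class-class∣ u≢w uw)
      move-to-rep : IsDist G u (rep (class w)) d
      move-to-rep = isDist-apart d (u≢w ∘ λ eq → trans eq rep-w) gap
    ... | yes u≡w with u ≟ w
    ...   | yes eq = inj₁ eq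
    ...   | no  u≢w =
      inj₂ (K′ , n≤1+n K′ , subst (IsDist G u (rep K′)) (isDist-unique (isDist-twin u≡w u≢w) uw) (isDist-between gap))
      where
      u≡K : class u ≡ K
      u≡K = ≤-antisym (class≤K u) (≮⇒≥ (u≢w ∘ class-injective u≡w))
      gap : ∣ class u - class (rep K′) ∣ ≡ 1
      gap = trans (cong₂ ∣_-_∣ u≡K (class-rep (n≤1+n K′))) (∣1+n-n∣≡1 K′)

    -- Induction on the Explorer's strategy tree, following the branch chosen by `reply`: token and
    -- visited set stay inside `reps`.
    confined : ∀ {m S u} → S ⊆ reps → u ∈ reps → CanForce G m S u → m ≤ suc K
    confined S⊆ u∈ (done m≤∣S∣) =
      ≤-trans m≤∣S∣ (≤-trans (p⊆q⇒∣p∣≤∣q∣ S⊆) (∣image∣≤ rep (suc K)))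
    confined S⊆ u∈ (move d (w , uw) next) with reply uw
    ... | inj₁ refl           = confined (∪-lub S⊆ (⁅x⁆⊆p u∈)) u∈ (next w uw)
    ... | inj₂ (i , i≤K , ui) = confined (∪-lub S⊆ (⁅x⁆⊆p i∈)) i∈ (next (rep i) ui)
      where
      i∈ : rep i ∈ reps
      i∈ = ∈-image rep (s≤s i≤K)

    upper : ∀ m → CanForce G m ⁅ v ⁆ v → m ≤ suc K
    upper m = confined (⁅x⁆⊆p v∈) v∈
      where
      v∈ : v ∈ reps
      v∈ = subst (_∈ reps) rep-class (∈-image rep (s≤s (class≤K v)))

  -- The Explorer's strategy: the lower bound.

  leaf : Fin b
  leaf = at 0

  class-leaf : class leaf ≡ 0
  class-leaf = class-at z≤n

  -- Twins occur only in class `K` and only at distance 1; the second hypothesis excludes this case,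
  -- so the reply must change class.
  isDist-exact : ∀ {u w d} → 1 ≤ d → class u < K ⊎ 2 ≤ d → IsDist G u w d →
                 ∣ class u - class w ∣ ≡ d
  isDist-exact {u} {w} 1≤d exact uw with class u ℕ.≟ class w
  ... | no  u≢w = isDist⇒∣class-class∣ u≢w uw
  ... | yes u≡w with u ≟ w
  ...   | yes refl = ⊥-elim (<⇒≢ 1≤d (isDist-unique isDist-refl uw))
  ...   | no  u≢w with exact
  ...     | inj₁ u<K = ⊥-elim (u≢w (class-injective u≡w u<K))
  ...     | inj₂ 2≤d = ⊥-elim (<⇒≢ 2≤d (isDist-unique (isDist-twin u≡w u≢w) uw))

  -- Class `j` makes the call legal. The Director is left with the classes `d` above and `d` below.
  force : ∀ {k S u} d j → j ≤ K → ∣ class u - j ∣ ≡ d → 1 ≤ d → class u < K ⊎ 2 ≤ d →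
          (∀ w → class w ≡ class u + d ⊎ class w + d ≡ class u → CanForce G k (S ∪ ⁅ w ⁆) w) →
          CanForce G k S u
  force {u = u} d@(suc _) j j≤K gap 1≤d exact next =
    move d (at j , isDist-between (trans (cong ∣ class u -_∣ (class-at j≤K)) gap))
      (λ w uw → next w (∣m-n∣≡d⇒ (class u) (class w) (isDist-exact 1≤d exact uw)))

  module Explorer (2≤K : 2 ≤ K) where

    -- Ranging over all supersets absorbs the vertices visited on the way to the leaf.
    ForcesFromLeaf : ℕ → Subset b → Set
    ForcesFromLeaf k S = ∀ {S′} → S ⊆ S′ → leaf ∈ S′ → CanForce G k S′ leaf

    extend : ∀ {k S} w → ForcesFromLeaf k S → ForcesFromLeaf k (S ∪ ⁅ w ⁆)
    extend w onward S⊆ = onward (S⊆ ∘ p⊆p∪q ⁅ w ⁆)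

    -- The call `class u` cannot be answered upwards, as twice the class exceeds `K`, and downwards
    -- it hits class 0.
    home-from-far : ∀ {k S u} → K < class u + class u → ForcesFromLeaf k S → CanForce G k S u
    home-from-far {k} {S} {u} K<2u onward =
      force (class u) 0 z≤n (∣-∣-identityʳ (class u)) (<⇒≤ 2≤u) (inj₂ 2≤u) arrive
      where
      -- Since `K` is at least 2, the call is at least 2, too long for a twin to answer.
      2≤u : 2 ≤ class u
      2≤u = ≰⇒> λ u≤1 → <⇒≱ K<2u (≤-trans (+-mono-≤ u≤1 u≤1) 2≤K)
      arrive : ∀ w → class w ≡ class u + class u ⊎ class w + class u ≡ class u →
               CanForce G k (S ∪ ⁅ w ⁆) w
      arrive w (inj₁ w≡2u)  = ⊥-elim (<⇒≱ K<2u (subst (_≤ K) w≡2u (class≤K w)))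
      arrive w (inj₂ w+u≡u) = subst (CanForce G k (S ∪ ⁅ w ⁆)) (sym w≡leaf)
        (onward (p⊆p∪q ⁅ w ⁆) (subst (_∈ S ∪ ⁅ w ⁆) w≡leaf (x∈p∪⁅x⁆ S w)))
        where
        w≡0 : class w ≡ 0
        w≡0 = +-cancelʳ-≡ (class u) (class w) 0 w+u≡u
        w≡leaf : w ≡ leaf
        w≡leaf = class-injective (trans w≡0 (sym class-leaf)) (subst (_< K) (sym w≡0) (s≤s z≤n))

    -- The call is the distance to the clique; it exceeds `class u`, so there is no downward reply,
    -- and the clique lies in the far half.
    home-from-near : ∀ {k S u} → class u + class u < K → ForcesFromLeaf k S → CanForce G k S u
    home-from-near {k} {S} {u} 2u<K onward =
      force (K ∸ class u) K ≤-refl (m≤n⇒∣m-n∣≡n∸m (<⇒≤ u<K)) (m<n⇒0<n∸m u<K) (inj₁ u<K) arrive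
      where
      u<K : class u < K
      u<K = ≤-<-trans (m≤m+n _ _) 2u<K
      u+[K∸u]≡K : class u + (K ∸ class u) ≡ K
      u+[K∸u]≡K = m+[n∸m]≡n (<⇒≤ u<K)
      arrive : ∀ w → class w ≡ class u + (K ∸ class u) ⊎ class w + (K ∸ class u) ≡ class u →
               CanForce G k (S ∪ ⁅ w ⁆) w
      arrive w (inj₁ eq) = home-from-far K<2w (extend w onward)
        where
        K<2w : K < class w + class w
        K<2w rewrite trans eq u+[K∸u]≡K = m<n+m K (s≤s z≤n)
      arrive w (inj₂ eq) = ⊥-elim (<⇒≱ 2u<K (begin
        K                          ≡⟨ u+[K∸u]≡K ⟨
        class u + (K ∸ class u)    ≤⟨ +-monoʳ-≤ (class u) (m≤n+m _ (class w)) ⟩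
        class u + (class w + (K ∸ class u)) ≡⟨ cong (class u +_) eq ⟩
        class u + class u          ∎))
        where open ≤-Reasoning

    home-from-centre : ∀ {k S u} → class u + class u ≡ K → ForcesFromLeaf k S → CanForce G k S u
    home-from-centre {k} {S} {u} 2u≡K onward =
      force 1 (suc (class u)) u<K (∣m-m+n∣′≡n (class u) 1 (+-comm (class u) 1)) ≤-refl (inj₁ u<K) arrive
      where
      0<u : 0 < class u
      0<u = n≢0⇒n>0 λ u≡0 → 0≢1+n (trans (sym (cong₂ _+_ u≡0 u≡0)) 2u≡K)
      u<K : class u < K
      u<K = subst (class u <_) 2u≡K (m<m+n (class u) 0<u)
      arrive : ∀ w → class w ≡ class u + 1 ⊎ class w + 1 ≡ class u → CanForce G k (S ∪ ⁅ w ⁆) w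
      arrive w (inj₁ eq) = home-from-far (subst (_< class w + class w) 2u≡K (+-mono-< u<w u<w)) (extend w onward)
        where
        u<w : class u < class w
        u<w = ≤-reflexive (trans (+-comm 1 (class u)) (sym eq))
      arrive w (inj₂ eq) = home-from-near (subst (class w + class w <_) 2u≡K (+-mono-< w<u w<u)) (extend w onward)
        where
        w<u : class w < class u
        w<u = ≤-reflexive (trans (+-comm 1 (class w)) eq)

    home : ∀ {k S} u → ForcesFromLeaf k S → CanForce G k S u
    home u with <-cmp (class u + class u) K
    ... | tri< 2u<K _ _ = home-from-near 2u<K
    ... | tri≈ _ 2u≡K _ = home-from-centre 2u≡K
    ... | tri> _ _ K<2u = home-from-far K<2u

    -- Classes `0` to `j` are visited and `r` remain. Nothing lies below the leaf, so the call
    -- `suc j` reaches exactly the next class, after which the token is brought home.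
    tour : ∀ r j {S} → r + suc j ≡ suc K → Covers class (suc j) S → CanForce G (suc K) S leaf
    tour zero    j     refl cov = done (covers⇒≤∣p∣ (suc j) cov)
    tour (suc r) j {S} eq   cov =
      force (suc j) (suc j) 1+j≤K (cong ∣_- suc j ∣ class-leaf) (s≤s z≤n)
        (inj₁ (subst (_< K) (sym class-leaf) (s≤s z≤n))) arrive
      where
      1+j≤K : suc j ≤ K
      1+j≤K = subst (suc j ≤_) (suc-injective eq) (m≤n+m (suc j) r)
      arrive : ∀ w → class w ≡ class leaf + suc j ⊎ class w + suc j ≡ class leaf →
               CanForce G (suc K) (S ∪ ⁅ w ⁆) w
      arrive w (inj₁ w≡) = home w λ S∪w⊆ _ →
        tour r (suc j) (trans (+-suc r (suc j)) eq)
          (covers-suc (S∪w⊆ (x∈p∪⁅x⁆ S w)) (trans w≡ (cong (_+ suc j) class-leaf))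
            (covers-mono (S∪w⊆ ∘ p⊆p∪q ⁅ w ⁆) cov))
      arrive w (inj₂ eq₀) = ⊥-elim (1+n≢0 (m+n≡0⇒n≡0 (class w) (trans eq₀ class-leaf)))

    lower : ∀ v → CanForce G (suc K) ⁅ v ⁆ v
    lower v = home v λ _ leaf∈ →
      tour K 0 (+-comm K 1) (covers-suc leaf∈ class-leaf (λ ()))

  lower-complete : 1 ≡ K → ∀ v → CanForce G (suc K) ⁅ v ⁆ v
  -- The vertex `at (1 ∸ class v)` lies in the other of the two classes, which makes the call legal;
  -- any reply at distance 1 differs from `v`.
  lower-complete refl v = move 1 (at (1 ∸ class v) , isDist-between gap) second
    where
    flip : ∀ {i} → i ≤ 1 → ∣ i - (1 ∸ i) ∣ ≡ 1
    flip {0} _ = refl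
    flip {1} _ = refl
    flip {suc (suc _)} (s≤s ())
    gap : ∣ class v - class (at (1 ∸ class v)) ∣ ≡ 1
    gap = trans (cong ∣ class v -_∣ (class-at (m∸n≤m 1 (class v)))) (flip (class≤K v))
    second : ∀ w → IsDist G v w 1 → CanForce G 2 (⁅ v ⁆ ∪ ⁅ w ⁆) w
    second w vw = done (subst (_< ∣ ⁅ v ⁆ ∪ ⁅ w ⁆ ∣) (∣⁅x⁆∣≡1 v)
      (p⊂q⇒∣p∣<∣q∣ (p⊆p∪q ⁅ w ⁆ , w , x∈p∪⁅x⁆ ⁅ v ⁆ w , w∉)))
      where
      w∉ : w ∉ ⁅ v ⁆
      w∉ w∈ with x∈⁅y⁆⇒x≡y v w∈
      ... | refl = 0≢1+n (isDist-unique isDist-refl vw)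

  isFd : ∀ v → IsFd G v (suc K)
  isFd v with m≤n⇒m<n∨m≡n (s≤s (z≤n {K′}))
  ... | inj₁ 2≤K = Explorer.lower 2≤K v , Director.upper v
  ... | inj₂ 1≡K = lower-complete 1≡K v , Director.upper v

corollary1p1 : ∀ (b k : ℕ) → 2 ≤ b → 2 ≤ k → k ≤ b →
    Σ[ G ∈ SimpleGraph b ] (Connected G × (∀ v → IsFd G v k))
corollary1p1 b (suc zero) _ (s≤s ()) _
corollary1p1 b (suc (suc K′)) _ _ k≤b = G , connected , isFd
  -- For `k = suc (suc K′)`, the bound `k ≤ b` unfolds to `suc K′ < b`.
  where open Lollipop b K′ k≤b
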